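{- Let $\Gamma=\mathbb{R}^n$, let $G$ be a finite permutation group on the coordinates of $\Gamma$, and let $\Lambda$ be a $G$-lattice in $\Gamma$. For any subgroup $H$ of $G$, with $\Lambda_0:=\{v\in\Lambda : v\theta_H\in\Lambda\}$, one has $$(\Lambda_0\theta_H)^{*} = \ker\theta_H \oplus (\Lambda_0)^{*}\theta_H .$$
   Context: $\langle u,v\rangle=\sum_{i}u_iv_i$ is the standard inner product on $\mathbb{R}^n$. A lattice in $\mathbb{R}^n$ is the $\mathbb{Z}$-span of an $\mathbb{R}$-basis of $\mathbb{R}^n$. A permutation group $G$ on $\{1,\dots,n\}$ acts on $\Gamma=\mathbb{R}^n$ on the right by $(vg)_i=v_{ig^{ -1}}$. A $G$-lattice is a lattice $\Lambda\subseteq\Gamma$ with $\Lambda g\subseteq\Lambda$ for all $g\in G$. For a subgroup $H\le G$, $\theta_H:=\frac{1}{|H|}\sum_{h\in H}h$, acting by $v\theta_H=\frac1{|H|}\sum_{h\in H}vh$; $X\theta_H:=\{v\theta_H:v\in X\}$ and $\ker\theta_H=\{v\in\Gamma:v\theta_H=0\}$. For a subset $X\subseteq\mathbb{R}^n$ (in particular for $\Lambda_0$ and for $\Lambda_0\theta_H$, which need not have rank $n$), $X^{*}:=\{u\in\mathbb{R}^n:\langle u,v\rangle\in\mathbb{Z}\text{ for all }v\in X\}$. The sum is an internal direct sum of additive subgroups of $\mathbb{R}^n$. -}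

module Defs where

open import Algebra.Bundles using (Group; AbelianGroup; CommutativeRing)
open import Algebra.Construct.Pointwise using (abelianGroup)
import Algebra.Properties.CommutativeMonoid.Sum as Sum
open import Data.Fin.Base using (Fin)
open import Data.Fin.Properties using (nonZeroIndex)
import Data.Fin.Permutation as Perm
open import Data.Fin.Permutation using (Permutation′; _⟨$⟩ʳ_; _⟨$⟩ˡ_; _∘ₚ_; flip)
open import Data.Integer.Base as ℤ using (ℤ; +_)
open import Data.Nat.Base as ℕ using (ℕ; _⊔_)
import Data.Nat.Properties as ℕ
open import Data.Product.Base using (∃-syntax; _×_; _,_; proj₁)
open import Data.Rational.Base as ℚ using (ℚ; 0ℚ; 1ℚ; ½; ∣_∣)
import Data.Rational.Properties as ℚ
open import Data.Rational.Solver using (module +-*-Solver)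
open import Data.Vec.Functional using (Vector)
open import Function.Base using (_∘_)
open import Function.Bundles using (_⇔_)
open import Level using (Level; 0ℓ)
open import Relation.Binary.Bundles using (Setoid)
open import Relation.Binary.PropositionalEquality
  using (_≡_; refl; sym; trans; cong; subst; subst₂)
open import Relation.Unary using (Pred; _∈_; _⊆_)

private
  variable
    c ℓ ℓ₁ ℓ₂ ℓ₃ : Level
    n : ℕ

-- Real numbers as Cauchy sequences of rationals; equality `_≃_` means that the
-- difference tends to zero.
record ℝ : Set where
  constructor mkℝ
  field
    seq    : ℕ → ℚ
    cauchy : ∀ ε → 0ℚ ℚ.< ε →
             ∃[ N ] ∀ i j → N ℕ.≤ i → N ℕ.≤ j → ∣ seq i ℚ.- seq j ∣ ℚ.< ε

open ℝ public

infix 4 _≃_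

record _≃_ (x y : ℝ) : Set where
  constructor mk≃
  field
    close : ∀ ε → 0ℚ ℚ.< ε →
            ∃[ N ] ∀ i → N ℕ.≤ i → ∣ seq x i ℚ.- seq y i ∣ ℚ.< ε

open _≃_ public

private
  0<* : ∀ {p q} → 0ℚ ℚ.< p → 0ℚ ℚ.< q → 0ℚ ℚ.< p ℚ.* q
  0<* {p} {q} 0<p 0<q = ℚ.positive⁻¹ (p ℚ.* q)
    where instance
      _ = ℚ.positive 0<p
      _ = ℚ.positive 0<q
      _ = ℚ.pos*pos⇒pos p q

  half : ℚ → ℚ
  half ε = ½ ℚ.* ε

  0<half : ∀ {ε} → 0ℚ ℚ.< ε → 0ℚ ℚ.< half ε
  0<half {ε} = 0<* {½} {ε} (ℚ.positive⁻¹ ½)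

  half+half : ∀ ε → half ε ℚ.+ half ε ≡ ε
  half+half ε = trans (sym (ℚ.*-distribʳ-+ ε ½ ½)) (ℚ.*-identityˡ ε)

  halves : ∀ {p q ε} → p ℚ.< half ε → q ℚ.< half ε → p ℚ.+ q ℚ.< ε
  halves {p} {q} {ε} p< q< = subst (p ℚ.+ q ℚ.<_) (half+half ε) (ℚ.+-mono-< p< q<)

  shrink : ∀ B → .{{ℚ.Positive B}} → ℚ → ℚ
  shrink B ε = (ℚ.1/ B) {{ℚ.pos⇒nonZero B}} ℚ.* ε

  0<shrink : ∀ B .{{_ : ℚ.Positive B}} {ε} → 0ℚ ℚ.< ε → 0ℚ ℚ.< shrink B ε
  0<shrink B {ε} = 0<* {p} {ε} (ℚ.positive⁻¹ p {{ℚ.1/pos⇒pos B}})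
    where p = (ℚ.1/ B) {{ℚ.pos⇒nonZero B}}

  *-shrink : ∀ B .{{_ : ℚ.Positive B}} ε → B ℚ.* shrink B ε ≡ ε
  *-shrink B ε = trans (sym (ℚ.*-assoc B (ℚ.1/ B) ε))
    (trans (cong (ℚ._* ε) (ℚ.*-inverseʳ B)) (ℚ.*-identityˡ ε))
    where instance _ = ℚ.pos⇒nonZero B

  module _ where
    open +-*-Solver

    swap-eq : ∀ p q → ℚ.- (p ℚ.- q) ≡ q ℚ.- p
    swap-eq = solve 2 (λ p q → :- (p :- q) := q :- p) refl

    trans-eq : ∀ p q r → (p ℚ.- q) ℚ.+ (q ℚ.- r) ≡ p ℚ.- r
    trans-eq = solve 3 (λ p q r → (p :- q) :+ (q :- r) := p :- r) refl

    neg-eq : ∀ p q → q ℚ.- p ≡ ℚ.- p ℚ.- ℚ.- q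
    neg-eq = solve 2 (λ p q → q :- p := :- p :- :- q) refl

    +-eq : ∀ p p′ q q′ →
           (p ℚ.- p′) ℚ.+ (q ℚ.- q′) ≡ (p ℚ.+ q) ℚ.- (p′ ℚ.+ q′)
    +-eq = solve 4 (λ p p′ q q′ →
      (p :- p′) :+ (q :- q′) := (p :+ q) :- (p′ :+ q′)) refl

    *-eq : ∀ p p′ q q′ → p ℚ.* (q ℚ.- q′) ℚ.+ q′ ℚ.* (p ℚ.- p′) ≡
                         (p ℚ.* q) ℚ.- (p′ ℚ.* q′)
    *-eq = solve 4 (λ p p′ q q′ →
      p :* (q :- q′) :+ q′ :* (p :- p′) := (p :* q) :- (p′ :* q′)) refl

    cancel-eq : ∀ p q → p ℚ.+ (q ℚ.- p) ≡ q
    cancel-eq = solve 2 (λ p q → p :+ (q :- p) := q) refl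

  triangle : ∀ p q {r} → p ℚ.+ q ≡ r → ∣ r ∣ ℚ.≤ ∣ p ∣ ℚ.+ ∣ q ∣
  triangle p q refl = ℚ.∣p+q∣≤∣p∣+∣q∣ p q

  self-close : ∀ p {ε} → 0ℚ ℚ.< ε → ∣ p ℚ.- p ∣ ℚ.< ε
  self-close p {ε} 0<ε =
    subst (λ q → ∣ q ∣ ℚ.< ε) (sym (ℚ.+-inverseʳ p)) 0<ε

  swap-close : ∀ p q {ε} → ∣ p ℚ.- q ∣ ℚ.< ε → ∣ q ℚ.- p ∣ ℚ.< ε
  swap-close p q {ε} = subst (ℚ._< ε)
    (trans (sym (ℚ.∣-p∣≡∣p∣ (p ℚ.- q))) (cong ∣_∣ (swap-eq p q)))

  trans-close : ∀ p q r {ε} → ∣ p ℚ.- q ∣ ℚ.< half ε →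
                ∣ q ℚ.- r ∣ ℚ.< half ε → ∣ p ℚ.- r ∣ ℚ.< ε
  trans-close p q r p~q q~r = ℚ.≤-<-trans
    (triangle (p ℚ.- q) (q ℚ.- r) (trans-eq p q r)) (halves p~q q~r)

  neg-close : ∀ p q {ε} → ∣ p ℚ.- q ∣ ℚ.< ε → ∣ ℚ.- p ℚ.- ℚ.- q ∣ ℚ.< ε
  neg-close p q {ε} p~q =
    subst (λ r → ∣ r ∣ ℚ.< ε) (neg-eq p q) (swap-close p q p~q)

  +-close : ∀ p p′ q q′ {ε} → ∣ p ℚ.- p′ ∣ ℚ.< half ε →
            ∣ q ℚ.- q′ ∣ ℚ.< half ε → ∣ (p ℚ.+ q) ℚ.- (p′ ℚ.+ q′) ∣ ℚ.< ε
  +-close p p′ q q′ p~p′ q~q′ = ℚ.≤-<-trans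
    (triangle (p ℚ.- p′) (q ℚ.- q′) (+-eq p p′ q q′)) (halves p~p′ q~q′)

  bounded-* : ∀ B .{{_ : ℚ.Positive B}} p q {ε} → ∣ p ∣ ℚ.≤ B →
              ∣ q ∣ ℚ.< shrink B ε → ∣ p ℚ.* q ∣ ℚ.< ε
  bounded-* B p q {ε} p≤B q< =
    subst₂ ℚ._<_ (sym (ℚ.∣p*q∣≡∣p∣*∣q∣ p q)) (*-shrink B ε)
      (ℚ.≤-<-trans (ℚ.*-monoʳ-≤-nonNeg ∣ q ∣ {{ℚ.∣-∣-nonNeg q}} p≤B)
                   (ℚ.*-monoʳ-<-pos B q<))

  *-close : ∀ B .{{_ : ℚ.Positive B}} C .{{_ : ℚ.Positive C}} p p′ q q′ {ε} →
            ∣ p ∣ ℚ.≤ B → ∣ q′ ∣ ℚ.≤ C →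
            ∣ p ℚ.- p′ ∣ ℚ.< shrink C (half ε) →
            ∣ q ℚ.- q′ ∣ ℚ.< shrink B (half ε) →
            ∣ (p ℚ.* q) ℚ.- (p′ ℚ.* q′) ∣ ℚ.< ε
  *-close B C p p′ q q′ p≤B q′≤C p~p′ q~q′ = ℚ.≤-<-trans
    (triangle (p ℚ.* (q ℚ.- q′)) (q′ ℚ.* (p ℚ.- p′)) (*-eq p p′ q q′))
    (halves (bounded-* B p (q ℚ.- q′) p≤B q~q′)
            (bounded-* C q′ (p ℚ.- p′) q′≤C p~p′))

  bound : ∀ x → ∃[ B ] ℚ.Positive B × ∃[ N ] ∀ i → N ℕ.≤ i → ∣ seq x i ∣ ℚ.≤ B
  bound x with cauchy x 1ℚ (ℚ.positive⁻¹ 1ℚ)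
  ... | N , near =
    ∣ s ∣ ℚ.+ 1ℚ , ℚ.nonNeg+pos⇒pos ∣ s ∣ {{ℚ.∣-∣-nonNeg s}} 1ℚ , N , λ i N≤i →
      ℚ.≤-trans (triangle s (seq x i ℚ.- s) (cancel-eq s (seq x i)))
        (ℚ.+-monoʳ-≤ ∣ s ∣ (ℚ.<⇒≤ (near i N N≤i ℕ.≤-refl)))
    where
    s = seq x N

  module _ {M N k : ℕ} where
    ≤ˡ : M ⊔ N ℕ.≤ k → M ℕ.≤ k
    ≤ˡ = ℕ.m⊔n≤o⇒m≤o M N

    ≤ʳ : M ⊔ N ℕ.≤ k → N ℕ.≤ k
    ≤ʳ = ℕ.m⊔n≤o⇒n≤o M N

  pointwise : ∀ {x y} → (∀ i → seq x i ≡ seq y i) → x ≃ y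
  pointwise {x} {y} x≗y = mk≃ λ ε 0<ε → 0 , λ i _ →
    subst (λ q → ∣ seq x i ℚ.- q ∣ ℚ.< ε) (x≗y i) (self-close (seq x i) 0<ε)

infixl 6 _+ᴿ_
infixl 7 _*ᴿ_
infix  8 -ᴿ_

fromℚ : ℚ → ℝ
fromℚ q = mkℝ (λ _ → q) (λ ε 0<ε → 0 , λ _ _ _ _ → self-close q 0<ε)

fromℤ : ℤ → ℝ
fromℤ z = fromℚ (z ℚ./ 1)

_+ᴿ_ : ℝ → ℝ → ℝ
seq    (x +ᴿ y) i = seq x i ℚ.+ seq y i
cauchy (x +ᴿ y) ε 0<ε =
  let M , near-x = cauchy x (half ε) (0<half {ε} 0<ε)
      N , near-y = cauchy y (half ε) (0<half {ε} 0<ε)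
  in M ⊔ N , λ i j ≤i ≤j →
       +-close (seq x i) (seq x j) (seq y i) (seq y j) {ε}
         (near-x i j (≤ˡ ≤i) (≤ˡ ≤j)) (near-y i j (≤ʳ {M} ≤i) (≤ʳ {M} ≤j))

-ᴿ_ : ℝ → ℝ
seq    (-ᴿ x) i = ℚ.- seq x i
cauchy (-ᴿ x) ε 0<ε = let N , near = cauchy x ε 0<ε in
  N , λ i j ≤i ≤j → neg-close (seq x i) (seq x j) {ε} (near i j ≤i ≤j)

_*ᴿ_ : ℝ → ℝ → ℝ
seq    (x *ᴿ y) i = seq x i ℚ.* seq y i
cauchy (x *ᴿ y) ε 0<ε =
  let B , B>0 , K , x≤B = bound x
      C , C>0 , L , y≤C = bound y
      M , near-x = cauchy x (shrink C {{C>0}} (half ε))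
                            (0<shrink C {{C>0}} {half ε} (0<half {ε} 0<ε))
      N , near-y = cauchy y (shrink B {{B>0}} (half ε))
                            (0<shrink B {{B>0}} {half ε} (0<half {ε} 0<ε))
  in (K ⊔ L) ⊔ (M ⊔ N) , λ i j ≤i ≤j →
       *-close B {{B>0}} C {{C>0}} (seq x i) (seq x j) (seq y i) (seq y j) {ε}
         (x≤B i (≤ˡ (≤ˡ ≤i))) (y≤C j (≤ʳ {K} (≤ˡ ≤j)))
         (near-x i j (≤ˡ (≤ʳ {K ⊔ L} ≤i)) (≤ˡ (≤ʳ {K ⊔ L} ≤j)))
         (near-y i j (≤ʳ {M} (≤ʳ {K ⊔ L} ≤i)) (≤ʳ {M} (≤ʳ {K ⊔ L} ≤j)))

private
  ≃-refl : ∀ {x} → x ≃ x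
  ≃-refl = pointwise (λ _ → refl)

  ≃-sym : ∀ {x y} → x ≃ y → y ≃ x
  ≃-sym {x} {y} x≃y = mk≃ λ ε 0<ε → let N , near = close x≃y ε 0<ε in
    N , λ i ≤i → swap-close (seq x i) (seq y i) {ε} (near i ≤i)

  ≃-trans : ∀ {x y z} → x ≃ y → y ≃ z → x ≃ z
  ≃-trans {x} {y} {z} x≃y y≃z = mk≃ λ ε 0<ε →
    let M , near  = close x≃y (half ε) (0<half {ε} 0<ε)
        N , near′ = close y≃z (half ε) (0<half {ε} 0<ε)
    in M ⊔ N , λ i ≤i → trans-close (seq x i) (seq y i) (seq z i) {ε}
         (near i (≤ˡ ≤i)) (near′ i (≤ʳ {M} ≤i))

  +ᴿ-cong : ∀ {x y u v} → x ≃ y → u ≃ v → x +ᴿ u ≃ y +ᴿ v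
  +ᴿ-cong {x} {y} {u} {v} x≃y u≃v = mk≃ λ ε 0<ε →
    let M , near  = close x≃y (half ε) (0<half {ε} 0<ε)
        N , near′ = close u≃v (half ε) (0<half {ε} 0<ε)
    in M ⊔ N , λ i ≤i → +-close (seq x i) (seq y i) (seq u i) (seq v i) {ε}
         (near i (≤ˡ ≤i)) (near′ i (≤ʳ {M} ≤i))

  -ᴿ-cong : ∀ {x y} → x ≃ y → -ᴿ x ≃ -ᴿ y
  -ᴿ-cong {x} {y} x≃y = mk≃ λ ε 0<ε → let N , near = close x≃y ε 0<ε in
    N , λ i ≤i → neg-close (seq x i) (seq y i) {ε} (near i ≤i)

  *ᴿ-cong : ∀ {x y u v} → x ≃ y → u ≃ v → x *ᴿ u ≃ y *ᴿ v
  *ᴿ-cong {x} {y} {u} {v} x≃y u≃v = mk≃ λ ε 0<ε →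
    let B , B>0 , K , x≤B = bound x
        C , C>0 , L , v≤C = bound v
        M , near  = close x≃y (shrink C {{C>0}} (half ε))
                              (0<shrink C {{C>0}} {half ε} (0<half {ε} 0<ε))
        N , near′ = close u≃v (shrink B {{B>0}} (half ε))
                              (0<shrink B {{B>0}} {half ε} (0<half {ε} 0<ε))
    in (K ⊔ L) ⊔ (M ⊔ N) , λ i ≤i →
         *-close B {{B>0}} C {{C>0}} (seq x i) (seq y i) (seq u i) (seq v i) {ε}
           (x≤B i (≤ˡ (≤ˡ ≤i))) (v≤C i (≤ʳ {K} (≤ˡ ≤i)))
           (near i (≤ˡ (≤ʳ {K ⊔ L} ≤i))) (near′ i (≤ʳ {M} (≤ʳ {K ⊔ L} ≤i)))

ℝ-commutativeRing : CommutativeRing 0ℓ 0ℓ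
ℝ-commutativeRing = record
  { Carrier = ℝ
  ; _≈_ = _≃_
  ; _+_ = _+ᴿ_
  ; _*_ = _*ᴿ_
  ; -_  = -ᴿ_
  ; 0#  = fromℚ 0ℚ
  ; 1#  = fromℚ 1ℚ
  ; isCommutativeRing = record
    { isRing = record
      { +-isAbelianGroup = record
        { isGroup = record
          { isMonoid = record
            { isSemigroup = record
              { isMagma = record
                { isEquivalence = record
                  { refl = ≃-refl ; sym = ≃-sym ; trans = ≃-trans }
                ; ∙-cong = +ᴿ-cong
                }
              ; assoc = λ x y z → pointwise λ i →
                  ℚ.+-assoc (seq x i) (seq y i) (seq z i)
              }
            ; identity = (λ x → pointwise λ i → ℚ.+-identityˡ (seq x i))
                       , (λ x → pointwise λ i → ℚ.+-identityʳ (seq x i))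
            }
          ; inverse = (λ x → pointwise λ i → ℚ.+-inverseˡ (seq x i))
                    , (λ x → pointwise λ i → ℚ.+-inverseʳ (seq x i))
          ; ⁻¹-cong = -ᴿ-cong
          }
        ; comm = λ x y → pointwise λ i → ℚ.+-comm (seq x i) (seq y i)
        }
      ; *-cong = *ᴿ-cong
      ; *-assoc = λ x y z → pointwise λ i →
          ℚ.*-assoc (seq x i) (seq y i) (seq z i)
      ; *-identity = (λ x → pointwise λ i → ℚ.*-identityˡ (seq x i))
                   , (λ x → pointwise λ i → ℚ.*-identityʳ (seq x i))
      ; distrib = (λ x y z → pointwise λ i →
                    ℚ.*-distribˡ-+ (seq x i) (seq y i) (seq z i))
                , (λ x y z → pointwise λ i →
                    ℚ.*-distribʳ-+ (seq x i) (seq y i) (seq z i))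
      }
    ; *-comm = λ x y → pointwise λ i → ℚ.*-comm (seq x i) (seq y i)
    }
  }

module ℝ-Ring = CommutativeRing ℝ-commutativeRing
open Sum ℝ-Ring.+-commutativeMonoid public using (sum)

record IsSubgroup (𝓖 : Group c ℓ₁) (S : Pred (Group.Carrier 𝓖) ℓ) :
                  Set (c Level.⊔ ℓ₁ Level.⊔ ℓ) where
  open Group 𝓖
  field
    resp      : ∀ {x y} → x ≈ y → x ∈ S → y ∈ S
    ε-closed  : ε ∈ S
    ∙-closed  : ∀ {x y} → x ∈ S → y ∈ S → x ∙ y ∈ S
    ⁻¹-closed : ∀ {x} → x ∈ S → x ⁻¹ ∈ S

record IsInternalDirectSum (𝓐 : AbelianGroup c ℓ)
         (S : Pred (AbelianGroup.Carrier 𝓐) ℓ₁)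
         (B : Pred (AbelianGroup.Carrier 𝓐) ℓ₂)
         (C : Pred (AbelianGroup.Carrier 𝓐) ℓ₃) :
         Set (c Level.⊔ ℓ Level.⊔ ℓ₁ Level.⊔ ℓ₂ Level.⊔ ℓ₃) where
  open AbelianGroup 𝓐
  field
    isSubgroupˡ : IsSubgroup group B
    isSubgroupʳ : IsSubgroup group C
    isSum       : ∀ x → x ∈ S ⇔ (∃[ b ] ∃[ c ] b ∈ B × c ∈ C × x ≈ b ∙ c)
    trivial-∩   : ∀ {x} → x ∈ B → x ∈ C → x ≈ ε

-- `g ∘ₚ h` applies `g` first, so this is the product for right actions.
SymmetricGroup : ℕ → Group 0ℓ 0ℓ
SymmetricGroup n = record
  { Carrier = Permutation′ n
  ; _≈_ = Perm._≈_
  ; _∙_ = _∘ₚ_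
  ; ε   = Perm.id
  ; _⁻¹ = flip
  ; isGroup = record
    { isMonoid = record
      { isSemigroup = record
        { isMagma = record
          { isEquivalence = record
            { refl  = λ _ → refl
            ; sym   = λ p i → sym (p i)
            ; trans = λ p q i → trans (p i) (q i)
            }
          ; ∙-cong = λ {g} {g′} {h} {h′} p q i →
              trans (q (g ⟨$⟩ʳ i)) (cong (h′ ⟨$⟩ʳ_) (p i))
          }
        ; assoc = λ _ _ _ _ → refl
        }
      ; identity = (λ _ _ → refl) , (λ _ _ → refl)
      }
    ; inverse = (λ g _ → Perm.inverseʳ g) , (λ g _ → Perm.inverseˡ g)
    ; ⁻¹-cong = λ {g} {h} p i →
        trans (sym (Perm.inverseˡ h))
          (cong (h ⟨$⟩ˡ_) (trans (sym (p _)) (Perm.inverseʳ g)))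
    }
  }

-- A subset of a finite type need not have a computable cardinality, so
-- finiteness is witnessed by a repetition-free enumeration up to `_≈_`.
record Enumeration (S : Setoid c ℓ) (P : Pred (Setoid.Carrier S) ℓ₁) :
                   Set (c Level.⊔ ℓ Level.⊔ ℓ₁) where
  open Setoid S
  field
    size       : ℕ
    elem       : Fin size → Carrier
    elem∈      : ∀ k → elem k ∈ P
    injective  : ∀ {k l} → elem k ≈ elem l → k ≡ l
    surjective : ∀ {x} → x ∈ P → ∃[ k ] elem k ≈ x

record PermutationGroup (n : ℕ) (ℓ : Level) : Set (Level.suc ℓ) where
  field
    Member      : Pred (Permutation′ n) ℓ
    isSubgroup  : IsSubgroup (SymmetricGroup n) Member
    enumeration : Enumeration (Group.setoid (SymmetricGroup n)) Member

  open IsSubgroup isSubgroup public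
  open Enumeration enumeration public

  instance
    size-nonZero : ℕ.NonZero size
    size-nonZero = nonZeroIndex (proj₁ (surjective ε-closed))

_≤ᴳ_ : PermutationGroup n ℓ₁ → PermutationGroup n ℓ₂ → Set (ℓ₁ Level.⊔ ℓ₂)
H ≤ᴳ G = PermutationGroup.Member H ⊆ PermutationGroup.Member G

Γ : ℕ → AbelianGroup 0ℓ 0ℓ
Γ n = abelianGroup (Fin n) ℝ-Ring.+-abelianGroup

ℝ^ : ℕ → Set
ℝ^ n = Vector ℝ n

infix 4 _≋_

_≋_ : ℝ^ n → ℝ^ n → Set
_≋_ {n} = AbelianGroup._≈_ (Γ n)

0ᵛ : ℝ^ n
0ᵛ {n} = AbelianGroup.ε (Γ n)

⟨_,_⟩ : ℝ^ n → ℝ^ n → ℝ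
⟨ u , v ⟩ = sum (λ i → u i *ᴿ v i)

linComb : ∀ {m} → (Fin m → ℝ) → (Fin m → ℝ^ n) → ℝ^ n
linComb c b i = sum (λ k → c k *ᴿ b k i)

record IsBasis {m} (b : Fin m → ℝ^ n) : Set where
  field
    spanning    : ∀ v → ∃[ c ] v ≋ linComb c b
    independent : ∀ c → linComb c b ≋ 0ᵛ → ∀ k → c k ≃ fromℤ (+ 0)

ℤ-span : ∀ {m} → (Fin m → ℝ^ n) → Pred (ℝ^ n) 0ℓ
ℤ-span {m = m} b v = ∃[ z ] v ≋ linComb {m = m} (fromℤ ∘ z) b

-- Any m admitting a basis is equal to n.
IsLattice : Pred (ℝ^ n) ℓ → Set ℓ
IsLattice {n} Λ =
  ∃[ m ] ∃[ b ] IsBasis {n} {m} b × (∀ v → v ∈ Λ ⇔ v ∈ ℤ-span b)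

infixl 8 _·_

-- The right action (v g)ᵢ = v_{i g⁻¹}; `g ⟨$⟩ˡ i` is i g⁻¹.
_·_ : ℝ^ n → Permutation′ n → ℝ^ n
(v · g) i = v (g ⟨$⟩ˡ i)

record IsGLattice (G : PermutationGroup n ℓ₁) (Λ : Pred (ℝ^ n) ℓ) :
                  Set (ℓ₁ Level.⊔ ℓ) where
  field
    isLattice : IsLattice Λ
    invariant : ∀ {g v} → g ∈ PermutationGroup.Member G → v ∈ Λ → v · g ∈ Λ

θ : PermutationGroup n ℓ → ℝ^ n → ℝ^ n
θ H v i = fromℚ (+ 1 ℚ./ size) *ᴿ sum (λ k → (v · elem k) i)
  where open PermutationGroup H

Image : (ℝ^ n → ℝ^ n) → Pred (ℝ^ n) ℓ → Pred (ℝ^ n) ℓ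
Image f X w = ∃[ v ] v ∈ X × w ≋ f v

Ker : (ℝ^ n → ℝ^ n) → Pred (ℝ^ n) 0ℓ
Ker f v = f v ≋ 0ᵛ

IsInteger : Pred ℝ 0ℓ
IsInteger x = ∃[ z ] x ≃ fromℤ z

infix 9 _✶

_✶ : Pred (ℝ^ n) ℓ → Pred (ℝ^ n) ℓ
(X ✶) u = ∀ v → v ∈ X → IsInteger ⟨ u , v ⟩

Λ₀ : PermutationGroup n ℓ₁ → Pred (ℝ^ n) ℓ → Pred (ℝ^ n) ℓ
Λ₀ H Λ v = v ∈ Λ × θ H v ∈ Λ

{-# OPTIONS --safe #-}

-- The averaging operator θ_H is idempotent and self-adjoint. Self-adjointness
-- turns u ∈ (Λ₀θ)* into uθ ∈ Λ₀*, so u = (u − uθ) + (uθ)θ is the required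
-- decomposition; conversely ⟨b + dθ, vθ⟩ = ⟨bθ + dθ, v⟩ = ⟨d, vθ⟩, which is an
-- integer because Λ₀ is closed under θ. The intersection is trivial since θ
-- fixes its image pointwise.

module Submission where

open import Defs hiding (sum)
open import Algebra.Bundles using (AbelianGroup; CommutativeMonoid; CommutativeRing; Group)
open import Algebra.Construct.Pointwise using (abelianGroup)
open import Algebra.Morphism.Structures using (IsMagmaHomomorphism)
import Algebra.Properties.CommutativeMonoid.Sum as MonoidSum
import Algebra.Properties.Group as GroupProperties
import Algebra.Properties.Semiring.Mult as Mult
import Algebra.Properties.Semiring.Sum as RingSum
open import Data.Fin.Base using (Fin)
open import Data.Fin.Permutation as Perm
  using (Permutation′; _⟨$⟩ʳ_; _⟨$⟩ˡ_; flip; permutation)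
open import Data.Integer.Base as ℤ using (+_)
import Data.Integer.Properties as ℤ
open import Data.Nat.Base as ℕ using (ℕ; zero; suc)
open import Data.Product.Base using (∃-syntax; _×_; _,_; proj₁; proj₂)
open import Data.Rational.Base as ℚ using (ℚ; 1ℚ; ∣_∣)
import Data.Rational.Properties as ℚ
open import Data.Rational.Unnormalised.Base as ℚᵘ using (mkℚᵘ; *≡*)
import Data.Rational.Unnormalised.Properties as ℚᵘ
open import Data.Vec.Functional using (Vector)
open import Function.Base using (_∘_)
open import Function.Bundles using (Equivalence; Inverse; mk⇔)
open import Level using (Level)
open import Relation.Binary.Bundles using (Setoid)
open import Relation.Binary.Core using (_Preserves_⟶_)
open import Relation.Binary.PropositionalEquality as ≡ using (_≡_)
import Relation.Binary.Reasoning.Setoid as SetoidReasoning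
open import Relation.Unary using (Pred; _∈_)

private
  variable
    a c ℓ ℓ₁ ℓ₂ ℓ₃ : Level
    n : ℕ

-- Summation over an enumerated subset

module _ {S : Setoid a ℓ₁} {P : Pred (Setoid.Carrier S) ℓ₂} (E : Enumeration S P)
         (M : CommutativeMonoid c ℓ) where
  open Setoid S
  open Enumeration E
  open CommutativeMonoid M using () renaming (Carrier to A; _≈_ to _≈ᴹ_)
  open MonoidSum M using (sum-permute; sum-cong-≋) renaming (sum to sumᴹ)

  module _ (φ : Inverse S S)
           (to∈ : ∀ {x} → x ∈ P → Inverse.to φ x ∈ P)
           (from∈ : ∀ {x} → x ∈ P → Inverse.from φ x ∈ P) where
    open Inverse φ

    private
      toᵢ fromᵢ : Fin size → Fin size
      toᵢ k   = proj₁ (surjective (to∈ (elem∈ k)))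
      fromᵢ k = proj₁ (surjective (from∈ (elem∈ k)))

      elem-toᵢ : ∀ k → elem (toᵢ k) ≈ to (elem k)
      elem-toᵢ k = proj₂ (surjective (to∈ (elem∈ k)))

      elem-fromᵢ : ∀ k → elem (fromᵢ k) ≈ from (elem k)
      elem-fromᵢ k = proj₂ (surjective (from∈ (elem∈ k)))

      π : Permutation′ size
      π = permutation toᵢ fromᵢ
        (λ k → injective (trans (elem-toᵢ (fromᵢ k)) (inverseˡ (elem-fromᵢ k))))
        (λ k → injective (trans (elem-fromᵢ (toᵢ k)) (inverseʳ (elem-toᵢ k))))

    -- `φ` restricts to a bijection of `P`, which induces the permutation `π` of the indices, and a
    -- commutative sum is unchanged by permuting its terms. Since `elem (toᵢ k)` is `to (elem k)`
    -- only up to `_≈_`, `f` has to respect `_≈_`.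
    sum-reindex : (f : Carrier → A) → f Preserves _≈_ ⟶ _≈ᴹ_ →
                  sumᴹ (f ∘ elem) ≈ᴹ sumᴹ (f ∘ to ∘ elem)
    sum-reindex f f-cong = CommutativeMonoid.trans M
      (sum-permute (f ∘ elem) π) (sum-cong-≋ (f-cong ∘ elem-toᵢ))

-- Right translation and inversion as bijections of a group

module _ (𝓖 : Group c ℓ) where
  open Group 𝓖
  open GroupProperties 𝓖

  rightTranslation : Carrier → Inverse setoid setoid
  rightTranslation g = record
    { to        = _∙ g
    ; from      = _// g
    ; to-cong   = ∙-congʳ
    ; from-cong = ∙-congʳ
    ; inverse   = (λ {x} y≈ → trans (∙-congʳ y≈) (//-rightDividesˡ g x))
                , (λ {x} y≈ → trans (∙-congʳ y≈) (//-rightDividesʳ g x))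
    }

  inversion : Inverse setoid setoid
  inversion = record
    { to        = _⁻¹
    ; from      = _⁻¹
    ; to-cong   = ⁻¹-cong
    ; from-cong = ⁻¹-cong
    ; inverse   = (λ y≈ → trans (⁻¹-cong y≈) (⁻¹-involutive _))
                , (λ y≈ → trans (⁻¹-cong y≈) (⁻¹-involutive _))
    }

-- Kernels and images of endomorphisms

module Endomorphism (𝓖 : Group c ℓ) {f : Group.Carrier 𝓖 → Group.Carrier 𝓖}
  (f-isHomo : IsMagmaHomomorphism (Group.rawMagma 𝓖) (Group.rawMagma 𝓖) f) where

  open Group 𝓖
  open GroupProperties 𝓖
  open IsMagmaHomomorphism f-isHomo using () renaming (⟦⟧-cong to f-cong; homo to f-homo)

  -- `f` is only assumed to preserve products; `f ε` is then idempotent, and the sole idempotent of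
  -- a group is `ε`.
  f-ε : f ε ≈ ε
  f-ε = identityˡ-unique (f ε) (f ε) (trans (sym (f-homo ε ε)) (f-cong (identityˡ ε)))

  f-⁻¹ : ∀ x → f (x ⁻¹) ≈ f x ⁻¹
  f-⁻¹ x = inverseˡ-unique (f (x ⁻¹)) (f x)
    (trans (sym (f-homo (x ⁻¹) x)) (trans (f-cong (inverseˡ x)) f-ε))

  kernel-isSubgroup : IsSubgroup 𝓖 (λ x → f x ≈ ε)
  kernel-isSubgroup = record
    { resp      = λ x≈y fx≈ε → trans (f-cong (sym x≈y)) fx≈ε
    ; ε-closed  = f-ε
    ; ∙-closed  = λ fx≈ε fy≈ε →
        trans (f-homo _ _) (trans (∙-cong fx≈ε fy≈ε) (identityˡ ε))
    ; ⁻¹-closed = λ fx≈ε → trans (f-⁻¹ _) (trans (⁻¹-cong fx≈ε) ε⁻¹≈ε)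
    }

  image-isSubgroup : {X : Pred Carrier ℓ₁} → IsSubgroup 𝓖 X →
                     IsSubgroup 𝓖 (λ y → ∃[ x ] x ∈ X × y ≈ f x)
  image-isSubgroup X-sub = record
    { resp      = λ y≈z (x , x∈ , y≈fx) → x , x∈ , trans (sym y≈z) y≈fx
    ; ε-closed  = ε , X.ε-closed , sym f-ε
    ; ∙-closed  = λ (x , x∈ , y≈fx) (x′ , x′∈ , z≈fx′) →
        x ∙ x′ , X.∙-closed x∈ x′∈ , trans (∙-cong y≈fx z≈fx′) (sym (f-homo x x′))
    ; ⁻¹-closed = λ (x , x∈ , y≈fx) →
        x ⁻¹ , X.⁻¹-closed x∈ , trans (⁻¹-cong y≈fx) (sym (f-⁻¹ x))
    }
    where module X = IsSubgroup X-sub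

-- Vectors over a commutative ring

-- Only the ring laws and 1/|H| are needed. The ring is kept abstract because at ℝ
-- unification η-expands Cauchy sequences and compares their convergence proofs.
module OverRing (R : CommutativeRing c ℓ) where
  open CommutativeRing R
  open RingSum semiring
  open Mult semiring using (×-assoc-*; ×-congʳ) renaming (_×_ to _⋆_)
  open SetoidReasoning setoid

  module V {n : ℕ} = AbelianGroup (abelianGroup (Fin n) +-abelianGroup)

  -- Permutation action and inner product

  infix 9 _ᵛ·_

  _ᵛ·_ : Vector Carrier n → Permutation′ n → Vector Carrier n
  (v ᵛ· g) i = v (g ⟨$⟩ˡ i)

  dot : Vector Carrier n → Vector Carrier n → Carrier
  dot u v = sum (λ i → u i * v i)

  dot-cong : {u u′ v v′ : Vector Carrier n} →
             u V.≈ u′ → v V.≈ v′ → dot u v ≈ dot u′ v′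
  dot-cong u≈u′ v≈v′ = sum-cong-≋ λ i → *-cong (u≈u′ i) (v≈v′ i)

  dot-congˡ : {u u′ : Vector Carrier n} (v : Vector Carrier n) →
              u V.≈ u′ → dot u v ≈ dot u′ v
  dot-congˡ v u≈u′ = dot-cong u≈u′ (V.refl {x = v})

  dot-comm : (u v : Vector Carrier n) → dot u v ≈ dot v u
  dot-comm u v = sum-cong-≋ λ i → *-comm (u i) (v i)

  dot-distribʳ : (w u v : Vector Carrier n) → dot (u V.∙ v) w ≈ dot u w + dot v w
  dot-distribʳ w u v = trans
    (sum-cong-≋ λ i → distribʳ (w i) (u i) (v i))
    (∑-distrib-+ (λ i → u i * w i) (λ i → v i * w i))

  dot-zeroˡ : (v : Vector Carrier n) → dot V.ε v ≈ 0#
  dot-zeroˡ v = trans (sym (*-distribˡ-sum 0# v)) (zeroˡ (sum v))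

  dot-⁻¹ˡ : (u v : Vector Carrier n) → dot (u V.⁻¹) v ≈ - dot u v
  dot-⁻¹ˡ u v = GroupProperties.inverseˡ-unique +-group _ _ (begin
    dot (u V.⁻¹) v + dot u v  ≈⟨ dot-distribʳ v (u V.⁻¹) u ⟨
    dot (u V.⁻¹ V.∙ u) v      ≈⟨ dot-congˡ v (V.inverseˡ u) ⟩
    dot V.ε v                 ≈⟨ dot-zeroˡ v ⟩
    0#                        ∎)

  -- Permutations act orthogonally, so the adjoint of `g` is its inverse: reindex the coordinates
  -- along `g`.
  dot-·ˡ : (u v : Vector Carrier n) (g : Permutation′ n) →
           dot (u ᵛ· g) v ≈ dot u (v ᵛ· flip g)
  dot-·ˡ u v g = trans
    (sum-permute (λ i → u (g ⟨$⟩ˡ i) * v i) g)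
    (sum-cong-≋ λ i → *-congʳ {v (g ⟨$⟩ʳ i)} (reflexive (≡.cong u (Perm.inverseˡ g {i}))))

  -- `Perm._≈_` compares forward maps while the action uses backward ones, hence the appeal to
  -- `⁻¹-cong`.
  ·-congʳ : (v : Vector Carrier n) {g h : Permutation′ n} →
            g Perm.≈ h → v ᵛ· g V.≈ v ᵛ· h
  ·-congʳ {n} v {g} {h} g≈h i =
    reflexive (≡.cong v (Group.⁻¹-cong (SymmetricGroup n) {g} {h} g≈h i))

  sum-const : ∀ m x → sum {m} (λ _ → x) ≈ (m ⋆ 1#) * x
  sum-const m x = begin
    sum {m} (λ _ → x)  ≈⟨ sum-replicate m ⟩
    m ⋆ x              ≈⟨ ×-congʳ m (*-identityˡ x) ⟨
    m ⋆ (1# * x)       ≈⟨ ×-assoc-* m 1# x ⟨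
    (m ⋆ 1#) * x       ∎

  -- θᴿ is specified up to ≈ rather than defined, so that `θ H` can be substituted
  -- for it verbatim.
  module Averaging {n : ℕ} (H : PermutationGroup n ℓ₁)
    (q : Carrier) (q-inverse : q * (PermutationGroup.size H ⋆ 1#) ≈ 1#)
    (θᴿ : Vector Carrier n → Vector Carrier n)
    (θᴿ-average : ∀ v i → θᴿ v i ≈ q * sum (λ k → (v ᵛ· PermutationGroup.elem H k) i))
    where
    open PermutationGroup H
      using (Member; enumeration; size; elem; elem∈; ∙-closed; ⁻¹-closed)

    θ-cong : θᴿ Preserves V._≈_ ⟶ V._≈_
    θ-cong {u} {v} u≈v i = begin
      θᴿ u i                           ≈⟨ θᴿ-average u i ⟩
      q * sum (λ k → (u ᵛ· elem k) i)  ≈⟨ *-congˡ (sum-cong-≋ λ k → u≈v (elem k ⟨$⟩ˡ i)) ⟩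
      q * sum (λ k → (v ᵛ· elem k) i)  ≈⟨ θᴿ-average v i ⟨
      θᴿ v i                           ∎

    θ-homo : ∀ u v → θᴿ (u V.∙ v) V.≈ θᴿ u V.∙ θᴿ v
    θ-homo u v i = begin
      θᴿ (u V.∙ v) i
        ≈⟨ θᴿ-average (u V.∙ v) i ⟩
      q * sum (λ k → (u ᵛ· elem k) i + (v ᵛ· elem k) i)
        ≈⟨ *-congˡ (∑-distrib-+ (λ k → (u ᵛ· elem k) i) (λ k → (v ᵛ· elem k) i)) ⟩
      q * (sum (λ k → (u ᵛ· elem k) i) + sum (λ k → (v ᵛ· elem k) i))
        ≈⟨ distribˡ q _ _ ⟩
      q * sum (λ k → (u ᵛ· elem k) i) + q * sum (λ k → (v ᵛ· elem k) i)
        ≈⟨ +-cong (θᴿ-average u i) (θᴿ-average v i) ⟨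
      θᴿ u i + θᴿ v i
        ∎

    -- `(v ᵛ· h) ᵛ· g` unfolds to the action of the product of `h` and `g`, and right translation by
    -- `g` permutes `H`, so the terms are merely reordered.
    θ-invariant : ∀ v {g} → g ∈ Member → θᴿ v ᵛ· g V.≈ θᴿ v
    θ-invariant v {g} g∈ i = begin
      θᴿ v (g ⟨$⟩ˡ i)
        ≈⟨ θᴿ-average v (g ⟨$⟩ˡ i) ⟩
      q * sum (λ k → (v ᵛ· elem k) (g ⟨$⟩ˡ i))
        ≈⟨ *-congˡ (sum-reindex enumeration +-commutativeMonoid
             (rightTranslation (SymmetricGroup n) g)
             (λ {h} h∈ → ∙-closed {h} {g} h∈ g∈)
             (λ {h} h∈ → ∙-closed {h} {flip g} h∈ (⁻¹-closed {g} g∈))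
             (λ h → (v ᵛ· h) i) (λ {g} {h} g≈h → ·-congʳ v {g} {h} g≈h i)) ⟨
      q * sum (λ k → (v ᵛ· elem k) i)
        ≈⟨ θᴿ-average v i ⟨
      θᴿ v i
        ∎

    θ-fixes-invariant : ∀ v → (∀ {g} → g ∈ Member → v ᵛ· g V.≈ v) → θᴿ v V.≈ v
    θ-fixes-invariant v v-inv i = begin
      θᴿ v i                           ≈⟨ θᴿ-average v i ⟩
      q * sum (λ k → (v ᵛ· elem k) i)  ≈⟨ *-congˡ (sum-cong-≋ λ k → v-inv (elem∈ k) i) ⟩
      q * sum {size} (λ _ → v i)       ≈⟨ *-congˡ (sum-const size (v i)) ⟩
      q * ((size ⋆ 1#) * v i)          ≈⟨ *-assoc q (size ⋆ 1#) (v i) ⟨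
      q * (size ⋆ 1#) * v i            ≈⟨ *-congʳ q-inverse ⟩
      1# * v i                         ≈⟨ *-identityˡ (v i) ⟩
      v i                              ∎

    θ-idem : ∀ v → θᴿ (θᴿ v) V.≈ θᴿ v
    θ-idem v = θ-fixes-invariant (θᴿ v) (θ-invariant v)

    -- Exchanging the sums over coordinates and over `H` lets the adjoint be taken one permutation
    -- at a time.
    dot-θˡ : ∀ u v → dot (θᴿ u) v ≈ q * sum (λ k → dot (u ᵛ· elem k) v)
    dot-θˡ u v = begin
      sum (λ i → θᴿ u i * v i)
        ≈⟨ sum-cong-≋ (λ i → *-congʳ {v i} (θᴿ-average u i)) ⟩
      sum (λ i → q * sum (λ k → (u ᵛ· elem k) i) * v i)
        ≈⟨ sum-cong-≋ (λ i → trans (*-assoc q _ (v i))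
             (*-congˡ (*-distribʳ-sum (v i) (λ k → (u ᵛ· elem k) i)))) ⟩
      sum (λ i → q * sum (λ k → (u ᵛ· elem k) i * v i))
        ≈⟨ *-distribˡ-sum q (λ i → sum (λ k → (u ᵛ· elem k) i * v i)) ⟨
      q * sum (λ i → sum (λ k → (u ᵛ· elem k) i * v i))
        ≈⟨ *-congˡ (∑-comm (λ i k → (u ᵛ· elem k) i * v i)) ⟩
      q * sum (λ k → dot (u ᵛ· elem k) v)
        ∎

    -- The adjoint of each `h` is its inverse, and inversion permutes `H`, so the average is its own
    -- adjoint.
    θ-selfAdjoint : ∀ u v → dot (θᴿ u) v ≈ dot u (θᴿ v)
    θ-selfAdjoint u v = begin
      dot (θᴿ u) v
        ≈⟨ dot-θˡ u v ⟩
      q * sum (λ k → dot (u ᵛ· elem k) v)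
        -- `dot-comm` puts `v` on the left, so that `dot-θˡ` applies again with the two vectors
        -- exchanged.
        ≈⟨ *-congˡ (sum-cong-≋ λ k →
             trans (dot-·ˡ u v (elem k)) (dot-comm u (v ᵛ· flip (elem k)))) ⟩
      q * sum (λ k → dot (v ᵛ· flip (elem k)) u)
        ≈⟨ *-congˡ (sum-reindex enumeration +-commutativeMonoid
             (inversion (SymmetricGroup n)) (λ {g} → ⁻¹-closed {g}) (λ {g} → ⁻¹-closed {g})
             (λ g → dot (v ᵛ· g) u)
             (λ {g} {h} g≈h → dot-congˡ u (·-congʳ v {g} {h} g≈h))) ⟨
      q * sum (λ k → dot (v ᵛ· elem k) u)
        ≈⟨ dot-θˡ v u ⟨
      dot (θᴿ v) u
        ≈⟨ dot-comm (θᴿ v) u ⟩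
      dot u (θᴿ v)
        ∎

    θ-isMagmaHomomorphism : IsMagmaHomomorphism V.rawMagma V.rawMagma θᴿ
    θ-isMagmaHomomorphism = record
      { isRelHomomorphism = record { cong = θ-cong } ; homo = θ-homo }

    open Endomorphism V.group θ-isMagmaHomomorphism

    -- Direct sum decomposition of the dual, relative to a subgroup of scalars

    module _ {Z : Pred Carrier ℓ₂} (Z-sub : IsSubgroup +-group Z)
             {Λ : Pred (Vector Carrier n) ℓ₃}
             (Λ-resp : ∀ {u v} → u V.≈ v → u ∈ Λ → v ∈ Λ) where
      private
        module Z = IsSubgroup Z-sub

        -- At ℝ, with `Z` the integers and `θᴿ` equal to `θ H`, these four predicates unfold to
        -- `_✶`, `Λ₀`, `Image` and `Ker`, so `dual-directSum` applies without conversion.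
        Dual : Pred (Vector Carrier n) a → Pred (Vector Carrier n) _
        Dual X u = ∀ v → v ∈ X → dot u v ∈ Z

        Λθ : Pred (Vector Carrier n) _
        Λθ v = v ∈ Λ × θᴿ v ∈ Λ

        Imageθ : Pred (Vector Carrier n) a → Pred (Vector Carrier n) _
        Imageθ X w = ∃[ v ] v ∈ X × w V.≈ θᴿ v

        Kerθ : Pred (Vector Carrier n) _
        Kerθ v = θᴿ v V.≈ V.ε

        Dual-isSubgroup : (X : Pred (Vector Carrier n) a) → IsSubgroup V.group (Dual X)
        Dual-isSubgroup X = record
          { resp      = λ x≈y x∈ v v∈ → Z.resp (dot-congˡ v x≈y) (x∈ v v∈)
          ; ε-closed  = λ v _ → Z.resp (sym (dot-zeroˡ v)) Z.ε-closed
          ; ∙-closed  = λ {x} {y} x∈ y∈ v v∈ →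
              Z.resp (sym (dot-distribʳ v x y)) (Z.∙-closed (x∈ v v∈) (y∈ v v∈))
          ; ⁻¹-closed = λ {x} x∈ v v∈ →
              Z.resp (sym (dot-⁻¹ˡ x v)) (Z.⁻¹-closed (x∈ v v∈))
          }

        u-θu∈Ker : ∀ u → u V.- θᴿ u ∈ Kerθ
        u-θu∈Ker u = V.trans (θ-homo u (θᴿ u V.⁻¹))
          (V.trans (V.∙-congˡ (V.trans (f-⁻¹ (θᴿ u)) (V.⁻¹-cong (θ-idem u))))
            (V.inverseʳ (θᴿ u)))

        θu∈Dual : ∀ {u} → u ∈ Dual (Imageθ Λθ) → θᴿ u ∈ Dual Λθ
        θu∈Dual {u} u∈ v v∈ =
          Z.resp (sym (θ-selfAdjoint u v)) (u∈ (θᴿ v) (v , v∈ , V.refl))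

        -- The second half of `v ∈ Λθ` is the first half of the goal; idempotence turns it into the
        -- other half as well.
        θ-preserves-Λθ : ∀ {v} → v ∈ Λθ → θᴿ v ∈ Λθ
        θ-preserves-Λθ {v} (_ , θv∈) = θv∈ , Λ-resp (V.sym (θ-idem v)) θv∈

        θ[b+θd]≈θd : ∀ b d → b ∈ Kerθ → θᴿ (b V.∙ θᴿ d) V.≈ θᴿ d
        θ[b+θd]≈θd b d θb≈ε = V.trans (θ-homo b (θᴿ d))
          (V.trans (V.∙-cong θb≈ε (θ-idem d)) (V.identityˡ (θᴿ d)))

        dot-Ker+Image : ∀ b d v → b ∈ Kerθ →
                        dot (b V.∙ θᴿ d) (θᴿ v) ≈ dot d (θᴿ v)
        dot-Ker+Image b d v b∈ = begin
          dot (b V.∙ θᴿ d) (θᴿ v)  ≈⟨ θ-selfAdjoint (b V.∙ θᴿ d) v ⟨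
          dot (θᴿ (b V.∙ θᴿ d)) v  ≈⟨ dot-congˡ v (θ[b+θd]≈θd b d b∈) ⟩
          dot (θᴿ d) v             ≈⟨ θ-selfAdjoint d v ⟩
          dot d (θᴿ v)             ∎

      dual-directSum : IsInternalDirectSum (abelianGroup (Fin n) +-abelianGroup)
                         (Dual (Imageθ Λθ)) Kerθ (Imageθ (Dual Λθ))
      dual-directSum = record
        { isSubgroupˡ = kernel-isSubgroup
        ; isSubgroupʳ = image-isSubgroup (Dual-isSubgroup Λθ)
        ; isSum       = λ u → mk⇔
            (λ u∈ → u V.- θᴿ u , θᴿ u , u-θu∈Ker u ,
              -- The chosen preimage of `θᴿ u` is `θᴿ u` rather than `u`, because it is the one
              -- known to lie in `Dual Λθ`.
              (θᴿ u , θu∈Dual u∈ , V.sym (θ-idem u)) ,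
              V.sym (GroupProperties.//-rightDividesˡ V.group (θᴿ u) u))
            (λ (b , c , b∈ , (d , d∈ , c≈θd) , u≈b+c) w (v , v∈ , w≈θv) →
              Z.resp
                (sym (trans (dot-cong (V.trans u≈b+c (V.∙-congˡ {_} {b} c≈θd)) w≈θv)
                  (dot-Ker+Image b d v b∈)))
                (d∈ (θᴿ v) (θ-preserves-Λθ v∈)))
        -- The chain is x = θd = θθd = θx = 0.
        ; trivial-∩   = λ θx≈ε (d , _ , x≈θd) →
            V.trans x≈θd (V.trans (V.sym (θ-idem d))
              (V.trans (V.sym (θ-cong x≈θd)) θx≈ε))
        }

-- Rational and integer constants in ℝ

module ≃ = Setoid ℝ-Ring.setoid

pointwise⇒≃ : ∀ {x y} → (∀ i → seq x i ≡ seq y i) → x ≃ y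
pointwise⇒≃ {x} {y} x≗y = mk≃ λ ε 0<ε → 0 , λ i _ →
  ≡.subst (λ q → ∣ q ∣ ℚ.< ε)
    (≡.sym (≡.trans (≡.cong (ℚ._- seq y i) (x≗y i)) (ℚ.+-inverseʳ (seq y i)))) 0<ε

-- Additivity is inherited from the injective homomorphism `toℚᵘ`. It moves identities to
-- unnormalised fractions, where equality is cross-multiplication and no gcd appears.
fromℚᵘ-homo-+ : ∀ p q → ℚ.fromℚᵘ (p ℚᵘ.+ q) ≡ ℚ.fromℚᵘ p ℚ.+ ℚ.fromℚᵘ q
fromℚᵘ-homo-+ p q = ℚ.toℚᵘ-injective (begin
  ℚ.toℚᵘ (ℚ.fromℚᵘ (p ℚᵘ.+ q))                      ≈⟨ ℚ.toℚᵘ-fromℚᵘ (p ℚᵘ.+ q) ⟩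
  p ℚᵘ.+ q
    ≈⟨ ℚᵘ.+-cong (ℚ.toℚᵘ-fromℚᵘ p) (ℚ.toℚᵘ-fromℚᵘ q) ⟨
  ℚ.toℚᵘ (ℚ.fromℚᵘ p) ℚᵘ.+ ℚ.toℚᵘ (ℚ.fromℚᵘ q)
    ≈⟨ ℚ.toℚᵘ-homo-+ (ℚ.fromℚᵘ p) (ℚ.fromℚᵘ q) ⟨
  ℚ.toℚᵘ (ℚ.fromℚᵘ p ℚ.+ ℚ.fromℚᵘ q)                ∎)
  where open SetoidReasoning ℚᵘ.≃-setoid

fromℚᵘ-homo-* : ∀ p q → ℚ.fromℚᵘ (p ℚᵘ.* q) ≡ ℚ.fromℚᵘ p ℚ.* ℚ.fromℚᵘ q
fromℚᵘ-homo-* p q = ℚ.toℚᵘ-injective (begin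
  ℚ.toℚᵘ (ℚ.fromℚᵘ (p ℚᵘ.* q))                      ≈⟨ ℚ.toℚᵘ-fromℚᵘ (p ℚᵘ.* q) ⟩
  p ℚᵘ.* q
    ≈⟨ ℚᵘ.*-cong (ℚ.toℚᵘ-fromℚᵘ p) (ℚ.toℚᵘ-fromℚᵘ q) ⟨
  ℚ.toℚᵘ (ℚ.fromℚᵘ p) ℚᵘ.* ℚ.toℚᵘ (ℚ.fromℚᵘ q)
    ≈⟨ ℚ.toℚᵘ-homo-* (ℚ.fromℚᵘ p) (ℚ.fromℚᵘ q) ⟨
  ℚ.toℚᵘ (ℚ.fromℚᵘ p ℚ.* ℚ.fromℚᵘ q)                ∎)
  where open SetoidReasoning ℚᵘ.≃-setoid

/1-homo-+ : ∀ a b → (a ℤ.+ b) ℚ./ 1 ≡ a ℚ./ 1 ℚ.+ b ℚ./ 1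
/1-homo-+ a b = ≡.trans
  (ℚ.fromℚᵘ-cong {mkℚᵘ (a ℤ.+ b) 0} {mkℚᵘ a 0 ℚᵘ.+ mkℚᵘ b 0}
    (*≡* (≡.cong (ℤ._* + 1)
      (≡.sym (≡.cong₂ ℤ._+_ (ℤ.*-identityʳ a) (ℤ.*-identityʳ b))))))
  (fromℚᵘ-homo-+ (mkℚᵘ a 0) (mkℚᵘ b 0))

fromℤ-homo-+ : ∀ a b → fromℤ (a ℤ.+ b) ≃ fromℤ a +ᴿ fromℤ b
fromℤ-homo-+ a b = pointwise⇒≃ λ _ → /1-homo-+ a b

fromℤ-homo-neg : ∀ a → fromℤ (ℤ.- a) ≃ -ᴿ fromℤ a
fromℤ-homo-neg a = GroupProperties.inverseˡ-unique ℝ-Ring.+-group (fromℤ (ℤ.- a)) (fromℤ a) (begin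
  fromℤ (ℤ.- a) +ᴿ fromℤ a  ≈⟨ fromℤ-homo-+ (ℤ.- a) a ⟨
  fromℤ (ℤ.- a ℤ.+ a)       ≡⟨ ≡.cong fromℤ (ℤ.+-inverseˡ a) ⟩
  ℝ-Ring.0#                 ∎)
  where open SetoidReasoning ℝ-Ring.setoid

IsInteger-resp : ∀ {x y} → x ≃ y → x ∈ IsInteger → y ∈ IsInteger
IsInteger-resp x≃y (z , x≃z) = z , ≃.trans (≃.sym x≃y) x≃z

IsInteger-isSubgroup : IsSubgroup ℝ-Ring.+-group IsInteger
IsInteger-isSubgroup = record
  { resp      = IsInteger-resp
  ; ε-closed  = + 0 , ≃.refl
  ; ∙-closed  = λ (a , x≃a) (b , y≃b) →
      a ℤ.+ b , ≃.trans (ℝ-Ring.+-cong x≃a y≃b) (≃.sym (fromℤ-homo-+ a b))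
  ; ⁻¹-closed = λ (a , x≃a) →
      ℤ.- a , ≃.trans (ℝ-Ring.-‿cong x≃a) (≃.sym (fromℤ-homo-neg a))
  }

open Mult ℝ-Ring.semiring using () renaming (_×_ to _⋆_)

-- Identifies the ring multiple required by `q-inverse` with a rational constant, term by term so
-- that Cauchy witnesses need not be compared.
seq-⋆1 : ∀ m i → seq (m ⋆ ℝ-Ring.1#) i ≡ + m ℚ./ 1
seq-⋆1 zero    i = ≡.refl
seq-⋆1 (suc m) i =
  ≡.trans (≡.cong (1ℚ ℚ.+_) (seq-⋆1 m i)) (≡.sym (/1-homo-+ (+ 1) (+ m)))

1/m*m≡1 : ∀ m .{{_ : ℕ.NonZero m}} → (+ 1 ℚ./ m) ℚ.* (+ m ℚ./ 1) ≡ 1ℚ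
-- `mkℚᵘ` stores the denominator minus one: `mkℚᵘ (+ 1) m` is 1/(m+1), and a final `0` means
-- denominator 1.
1/m*m≡1 (suc m) = ≡.trans (≡.sym (fromℚᵘ-homo-* (mkℚᵘ (+ 1) m) (mkℚᵘ (+ suc m) 0)))
  (ℚ.fromℚᵘ-cong {mkℚᵘ (+ 1) m ℚᵘ.* mkℚᵘ (+ suc m) 0} {mkℚᵘ (+ 1) 0}
    (*≡* (≡.trans (ℤ.*-identityʳ (+ 1 ℤ.* + suc m)) (≡.cong (+ 1 ℤ.*_)
      (≡.sym (ℤ.*-identityʳ (+ suc m)))))))

-- `Λ` is a bare predicate, but it coincides with a ℤ-span, and membership in the span is itself
-- stated up to `_≋_`.
lattice-resp : {Λ : Pred (ℝ^ n) ℓ} → IsLattice Λ →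
               ∀ {u v} → u ≋ v → u ∈ Λ → v ∈ Λ
lattice-resp {n} (_ , _ , _ , Λ⇔span) {u} {v} u≋v u∈ =
  let z , u≋ = Equivalence.to (Λ⇔span u) u∈
  in Equivalence.from (Λ⇔span v) (z , AbelianGroup.trans (Γ n) (AbelianGroup.sym (Γ n) u≋v) u≋)

theorem4p1 : ∀ {ℓG ℓH ℓΛ : Level} (n : ℕ) (G : PermutationGroup n ℓG)
    (Λ : Pred (ℝ^ n) ℓΛ) → IsGLattice G Λ →
    (H : PermutationGroup n ℓH) → H ≤ᴳ G →
    IsInternalDirectSum (Γ n) ((Image (θ H) (Λ₀ H Λ)) ✶)
    (Ker (θ H)) (Image (θ H) ((Λ₀ H Λ) ✶))
theorem4p1 n G Λ Λ-lattice H H≤G = dual-directSum IsInteger-isSubgroup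
  (lattice-resp (IsGLattice.isLattice Λ-lattice))
  where
  open PermutationGroup H using (size; size-nonZero)
  open OverRing ℝ-commutativeRing

  q : ℚ
  q = (+ 1 ℚ./ size) {{size-nonZero}}

  -- The averaging specification holds by `refl` on every term of the Cauchy sequences, since `θ H`
  -- is defined by that very formula.
  open Averaging H (fromℚ q)
    (pointwise⇒≃ λ i →
      ≡.trans (≡.cong (q ℚ.*_) (seq-⋆1 size i)) (1/m*m≡1 size {{size-nonZero}}))
    (θ H) (λ v i → pointwise⇒≃ λ _ → ≡.refl)
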